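{- Let $k$ be a positive integer and $n_1, \dots, n_k \geq 2$ integers. Then $B(\square^k_{i=1} P_{n_i}) \leq \left\lfloor \frac{5k}{2} \right\rfloor$.
   Context: $P_n$ is the path on $n$ vertices and $\square^k_{i=1} P_{n_i} = P_{n_1}\square\cdots\square P_{n_k}$ is the $k$-dimensional Cartesian grid, where the Cartesian product $G\square H$ has vertex set $V(G)\times V(H)$, with $(u,v)$ adjacent to $(x,y)$ iff either $ux\in E(G)$ and $v=y$, or $u=x$ and $vy\in E(H)$. Bodyguards and Presidents is a two-player game on a finite simple graph $G$. One player controls a set of tokens called bodyguards, the other a single token called the president. First all bodyguards are placed on vertices (several may share a vertex), then the president is placed. The players then alternate turns, bodyguards first; on a player's turn, each token they control either moves to an adjacent vertex or stays put. The president is surrounded if every vertex of the open neighbourhood of the president's vertex is occupied by a bodyguard. The bodyguards win if there is a finite time after which, at the end of every bodyguard turn, the president is surrounded; otherwise the president wins. The bodyguard number $B(G)$ is the minimum number of bodyguards that guarantees a win for the bodyguards on $G$. -}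

module Defs where

open import Level using (0ℓ)
open import Data.Nat using (ℕ; zero; suc; _≤_)
open import Data.Fin using (Fin; toℕ)
open import Data.Vec using (Vec; []; _∷_)
open import Data.Product using (Σ; ∃; _×_; _,_; proj₁; proj₂)
open import Data.Sum using (_⊎_)
open import Data.List using (List; []; _∷_)
open import Relation.Binary.PropositionalEquality using (_≡_)

record Graph : Set₁ where
  field
    V   : Set
    Adj : V → V → Set
open Graph public

P : ℕ → Graph
P n = record { V = Fin n ; Adj = λ i j → (toℕ j ≡ suc (toℕ i)) ⊎ (toℕ i ≡ suc (toℕ j)) }

_□_ : Graph → Graph → Graph
G □ H = record
  { V   = V G × V H
  ; Adj = λ a b → (Adj G (proj₁ a) (proj₁ b) × proj₂ a ≡ proj₂ b)
                ⊎ (proj₁ a ≡ proj₁ b × Adj H (proj₂ a) (proj₂ b)) }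

Grid : ∀ {k} → Vec ℕ (suc k) → Graph
Grid (n ∷ [])     = P n
Grid (n ∷ m ∷ ns) = P n □ Grid (m ∷ ns)

module Game (G : Graph) (m : ℕ) where
  -- positions of the m bodyguards (several may share a vertex)
  Config : Set
  Config = Fin m → V G

  Step : V G → V G → Set
  Step u v = (u ≡ v) ⊎ Adj G u v

  LegalMove : Config → Config → Set
  LegalMove c c' = ∀ j → Step (c j) (c' j)

  Surrounded : Config → V G → Set
  Surrounded c p = ∀ v → Adj G p v → ∃ λ j → c j ≡ v

  -- Histories: list of past states (Config × president vertex), most recent first.
  History : Set
  History = List (Config × V G)

  -- Bodyguard strategy: initial placement, and a move given the current
  -- state (bodyguards c, president p) and the earlier history.
  record BStrategy : Set where
    field
      place : Config
      move  : Config → V G → History → Config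
      legal : ∀ c p h → LegalMove c (move c p h)

  -- President strategy: placement after seeing the bodyguards, and a move
  -- given the new bodyguard positions, his current vertex and the history.
  record PStrategy : Set where
    field
      place : Config → V G
      move  : Config → V G → History → V G
      legal : ∀ c p h → Step p (move c p h)

  -- state at the start of round t (after the president's placement / move),
  -- together with the history before it
  run : BStrategy → PStrategy → ℕ → (Config × V G) × History
  run σ τ zero = (BStrategy.place σ , PStrategy.place τ (BStrategy.place σ)) , []
  run σ τ (suc t) with run σ τ t
  ... | (c , p) , h =
    let c' = BStrategy.move σ c p h
    in (c' , PStrategy.move τ c' p ((c , p) ∷ h)) , (c , p) ∷ h

  -- bodyguard positions at the end of the bodyguard turn of round t (t = 0,1,…)
  -- and the president position at that moment
  bgAfter : BStrategy → PStrategy → ℕ → Config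
  bgAfter σ τ t with run σ τ t
  ... | (c , p) , h = BStrategy.move σ c p h

  presAt : BStrategy → PStrategy → ℕ → V G
  presAt σ τ t = proj₂ (proj₁ (run σ τ t))

  BodyguardsWin : Set
  BodyguardsWin = Σ BStrategy λ σ → ∀ (τ : PStrategy) →
    ∃ λ T → ∀ t → T ≤ t → Surrounded (bgAfter σ τ t) (presAt σ τ t)

-- B(G) ≤ b : the minimum winning number of bodyguards is at most b,
-- i.e. some m ≤ b bodyguards have a winning strategy.
BG≤ : Graph → ℕ → Set
BG≤ G b = ∃ λ m → m ≤ b × Game.BodyguardsWin G m

{-# OPTIONS --safe #-}

-- Each of the 2k vertices p ± eᵢ, clamped to the grid, is a shadow of the president p: it moves
-- at most one step when p does, and the shadows of p include all its neighbours.  A guard standing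
-- on a shadow can follow it forever, so it suffices to catch the shadows one after the other,
-- with ⌊k/2⌋ + 1 pursuers being free for the last one.
--
-- One eager pursuer owns the last coordinate; it always approaches its prey, closing the last
-- coordinate only when all others agree.  The ⌊k/2⌋ patient pursuers own the disjoint pairs {a, b} of
-- coordinates; a patient pursuer moves only when its distance is odd, and then closes coordinates
-- other than a and b if it can, else the larger of the distances at a and b.  As long as nothing
-- is caught, the rank (distance, distance outside the own coordinates, imbalance of the two own
-- distances, room left to the prey in the own coordinates) of no pursuer increases
-- lexicographically.  It drops for the eager pursuer when the prey rests, and for the owner of
-- coordinate i when the prey moves in direction i; every coordinate has an owner.
module Submission where

open import Defs
open import Data.Nat using (ℕ; suc; _≤_; _*_)
open import Data.Nat.DivMod using (_/_)
open import Data.Fin using (Fin)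
open import Data.Vec using (Vec; lookup)

open import Data.Bool using (Bool; true; false; not; if_then_else_; T)
open import Data.Bool.Properties using (not-involutive)
open import Data.Fin using (zero; suc; toℕ; fromℕ; fromℕ<; splitAt; join; punchIn; punchOut; remQuot; combine; _↑ʳ_)
open import Data.Fin.Properties using (any?; all?; splitAt-join; punchIn-punchOut; punchInᵢ≢i; toℕ<n; toℕ-injective; toℕ-fromℕ; toℕ-fromℕ<; remQuot-combine)
open import Data.List using (List; []; _∷_; allFin)
open import Data.List.Membership.Propositional using (_∈_)
open import Data.List.Membership.Propositional.Properties using (∈-allFin)
open import Data.List.Relation.Unary.Any using (here; there)
open import Data.Nat using (zero; pred; _+_; _∸_; _⊓_; _<_; z≤n; s≤s; s≤s⁻¹; _<ᵇ_; _≤′_; ≤′-refl; ≤′-step; ∣_-_∣; ⌊_/2⌋)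
open import Data.Nat.DivMod using (/-monoˡ-≤; m*n/n≡m)
open import Data.Nat.Properties
open import Data.Nat.Solver using (module +-*-Solver)
open import Data.Product using (∃; _×_; _,_; proj₁; proj₂; map)
open import Data.Sum using (_⊎_; inj₁; inj₂; [_,_]′)
open import Data.Vec using ([]; _∷_)
open import Function using (_∘_; case_of_)
open import Relation.Binary using (DecidableEquality)
open import Relation.Binary.PropositionalEquality
open import Relation.Nullary using (¬_; Dec; yes; no; contradiction; ¬?; _×-dec_; _⊎-dec_)
open import Relation.Nullary.Decidable using (decidable-stable; map′)
open import Algebra.Properties.CommutativeMonoid.Sum +-0-commutativeMonoid using (sum; sum-cong-≗; sum-remove; sum-replicate-zero)
import Data.Fin.Properties as Fin
import Data.Sum as Sum
import Data.Sum.Properties as Sum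

-- Finite sums

sum-mono-≤ : ∀ {n} {f g : Fin n → ℕ} → (∀ i → f i ≤ g i) → sum f ≤ sum g
sum-mono-≤ {zero}  f≤g = z≤n
sum-mono-≤ {suc n} f≤g = +-mono-≤ (f≤g zero) (sum-mono-≤ (f≤g ∘ suc))

sum-mono-< : ∀ {n} {f g : Fin n → ℕ} → (∀ i → f i ≤ g i) → ∀ i → f i < g i → sum f < sum g
sum-mono-< f≤g zero    f<g = +-mono-<-≤ f<g (sum-mono-≤ (f≤g ∘ suc))
sum-mono-< f≤g (suc i) f<g = +-mono-≤-< (f≤g zero) (sum-mono-< (f≤g ∘ suc) i f<g)

sum-zero : ∀ {n} {f : Fin n → ℕ} → (∀ i → f i ≡ 0) → sum f ≡ 0
sum-zero {n} f≡0 = trans (sum-cong-≗ f≡0) (sum-replicate-zero n)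

sum-zero⁻ : ∀ {n} {f : Fin n → ℕ} → sum f ≡ 0 → ∀ i → f i ≡ 0
sum-zero⁻ {f = f} eq zero    = m+n≡0⇒m≡0 (f zero) eq
sum-zero⁻ {f = f} eq (suc i) = sum-zero⁻ (m+n≡0⇒n≡0 (f zero) eq) i

sum-suc : ∀ {n} {f g : Fin (suc n) → ℕ} i → g i ≡ suc (f i) → (∀ {j} → j ≢ i → g j ≡ f j) →
          sum g ≡ suc (sum f)
sum-suc {f = f} {g} i at off = begin
  sum g                              ≡⟨ sum-remove {i = i} g ⟩
  g i + sum (g ∘ punchIn i)          ≡⟨ cong₂ _+_ at (sum-cong-≗ (λ j → off (punchInᵢ≢i i j))) ⟩
  suc (f i + sum (f ∘ punchIn i))    ≡⟨ cong suc (sum-remove {i = i} f) ⟨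
  suc (sum f)                        ∎
  where open ≡-Reasoning

sum-single : ∀ {n} {f : Fin n → ℕ} a → (∀ {i} → i ≢ a → f i ≡ 0) → sum f ≡ f a
sum-single {suc n} {f} a off = begin
  sum f                      ≡⟨ sum-remove {i = a} f ⟩
  f a + sum (f ∘ punchIn a)  ≡⟨ cong (f a +_) (sum-zero λ j → off (punchInᵢ≢i a j)) ⟩
  f a + 0                    ≡⟨ +-identityʳ (f a) ⟩
  f a                        ∎
  where open ≡-Reasoning

sum-pair : ∀ {n} {f : Fin n → ℕ} {a b} → a ≢ b → (∀ {i} → i ≢ a → i ≢ b → f i ≡ 0) →
           sum f ≡ f a + f b
sum-pair {suc n} {f} {a} {b} a≢b off = begin
  sum f                                    ≡⟨ sum-remove {i = a} f ⟩
  f a + sum (f ∘ punchIn a)                ≡⟨ cong (f a +_) (sum-single (punchOut a≢b) rest) ⟩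
  f a + f (punchIn a (punchOut a≢b))       ≡⟨ cong (λ i → f a + f i) (punchIn-punchOut a≢b) ⟩
  f a + f b                                ∎
  where
  open ≡-Reasoning
  rest : ∀ {j} → j ≢ punchOut a≢b → f (punchIn a j) ≡ 0
  rest {j} j≢ = off (punchInᵢ≢i a j) λ eq →
    j≢ (Fin.punchIn-injective a _ _ (trans eq (sym (punchIn-punchOut a≢b))))

-- The escort game

Step : (G : Graph) → V G → V G → Set
Step G u v = u ≡ v ⊎ Adj G u v

-- The vertices hunt i w x are the positions at the end of a pursuers' turn, so the
-- two rank laws compare the ends of consecutive turns.
record Pursuers (G : Graph) (e : ℕ) : Set where
  field
    hunt       : Fin (suc e) → V G → V G → V G
    hunt-step  : ∀ i y x → Step G y (hunt i y x)
    hunt-catch : ∀ {y x} → Step G y x → hunt zero y x ≡ x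
    rank       : Fin (suc e) → V G → V G → ℕ
    rank-≤     : ∀ i w {x x′} → hunt i w x ≢ x → Step G x x′ →
                 rank i (hunt i (hunt i w x) x′) x′ ≤ rank i (hunt i w x) x
    rank-<     : ∀ (w : Fin (suc e) → V G) {x x′} → (∀ i → hunt i (w i) x ≢ x) → Step G x x′ →
                 ∃ λ i → rank i (hunt i (hunt i (w i) x) x′) x′ < rank i (hunt i (w i) x) x

record Shadows (G : Graph) (N : ℕ) : Set where
  field
    shadow      : Fin N → V G → V G
    shadow-step : ∀ s {p p′} → Step G p p′ → Step G (shadow s p) (shadow s p′)
    shadow-adj  : ∀ {p v} → Adj G p v → ∃ λ s → shadow s p ≡ v

module Swap {A : Set} (_≟_ : DecidableEquality A) where

  swap : A → A → A → A
  swap a b x with x ≟ a | x ≟ b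
  ... | yes _ | _     = b
  ... | no  _ | yes _ = a
  ... | no  _ | no  _ = x

  swap-right : ∀ a b → swap a b b ≡ a
  swap-right a b with b ≟ a | b ≟ b
  ... | yes b≡a | _     = b≡a
  ... | no  _   | yes _ = refl
  ... | no  _   | no b≢b = contradiction refl b≢b

  swap-left : ∀ a b → swap a b a ≡ b
  swap-left a b with a ≟ a
  ... | yes _   = refl
  ... | no a≢a = contradiction refl a≢a

  swap-other : ∀ {a b x} → x ≢ a → x ≢ b → swap a b x ≡ x
  swap-other {a} {b} {x} x≢a x≢b with x ≟ a | x ≟ b
  ... | yes x≡a | _       = contradiction x≡a x≢a
  ... | no  _   | yes x≡b = contradiction x≡b x≢b
  ... | no  _   | no  _   = refl

  swap-involutive : ∀ a b x → swap a b (swap a b x) ≡ x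
  swap-involutive a b x with x ≟ a | x ≟ b
  ... | yes refl | _        = swap-right a b
  ... | no  _    | yes refl = swap-left a b
  ... | no x≢a   | no x≢b   = swap-other x≢a x≢b

-- The guards' strategy built from pursuers and shadows

module Escort (G : Graph) (_≟_ : DecidableEquality (V G)) (base : V G)
              {e N : ℕ} (pursuers : Pursuers G e) (shadows : Shadows G N) where

  open Pursuers pursuers
  open Shadows shadows
  open Game G (e + N) hiding (Step)

  -- The holder of inj₂ s follows shadow s forever; the holder of inj₁ i is pursuer
  -- suc i after the shadow hunted at the moment.
  Role : Set
  Role = Fin e ⊎ Fin N

  open Swap (Sum.≡-dec (Fin._≟_ {e}) (Fin._≟_ {N}))

  record Memory : Set where
    field
      todo       : List (Fin N)
      role       : Fin (e + N) → Role
      guard      : Role → Fin (e + N)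
      role-guard : ∀ r → role (guard r) ≡ r
  open Memory

  -- Pursuer `zero` is the guard that is destined to follow the hunted shadow anyway. Hence `e`
  -- guards beyond the `N` followers make up a team of `suc e` pursuers.
  pursuer : Fin N → Fin (suc e) → Role
  pursuer x zero    = inj₂ x
  pursuer x (suc i) = inj₁ i

  play : List (Fin N) → Role → V G → V G → V G
  play _       (inj₂ s) p y = hunt zero y (shadow s p)
  play []      (inj₁ i) p y = y
  play (x ∷ _) (inj₁ i) p y = hunt (suc i) y (shadow x p)

  play-step : ∀ xs r p y → Step G y (play xs r p y)
  play-step _       (inj₂ s) p y = hunt-step zero y _
  play-step []      (inj₁ i) p y = inj₁ refl
  play-step (x ∷ _) (inj₁ i) p y = hunt-step (suc i) y _

  play-pursuer : ∀ x xs i p y → play (x ∷ xs) (pursuer x i) p y ≡ hunt i y (shadow x p)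
  play-pursuer x xs zero    p y = refl
  play-pursuer x xs (suc i) p y = refl

  act : Memory → Config → V G → Config
  act M c p g = play (todo M) (role M g) p (c g)

  act-guard : ∀ M c p r → act M c p (guard M r) ≡ play (todo M) r p (c (guard M r))
  act-guard M c p r = cong (λ q → play (todo M) q p (c (guard M r))) (role-guard M r)

  act-pursuer : ∀ M {x xs} → todo M ≡ x ∷ xs → ∀ c p i →
    act M c p (guard M (pursuer x i)) ≡ hunt i (c (guard M (pursuer x i))) (shadow x p)
  act-pursuer M {x} {xs} eq c p i =
    trans (act-guard M c p (pursuer x i))
          (trans (cong (λ z → play z (pursuer x i) p _) eq) (play-pursuer x xs i p _))

  -- The catcher and the designated follower of `x` exchange roles, so every role stays filled. For
  -- `i = zero` they are the same guard and the exchange is the identity.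
  promote : Memory → Fin N → List (Fin N) → Fin (suc e) → Memory
  promote M x xs i = record
    { todo       = xs
    ; role       = swap (pursuer x i) (inj₂ x) ∘ role M
    ; guard      = guard M ∘ swap (pursuer x i) (inj₂ x)
    ; role-guard = λ r → trans (cong (swap _ _) (role-guard M _)) (swap-involutive _ _ r)
    }

  Caught : Memory → Config → V G → Fin N → Fin (suc e) → Set
  Caught M c p x i = c (guard M (pursuer x i)) ≡ shadow x p

  remember : Memory → Config → V G → Memory
  remember M c p with todo M
  ... | []     = M
  ... | x ∷ xs with any? (λ i → c (guard M (pursuer x i)) ≟ shadow x p)
  ...   | yes (i , _) = promote M x xs i
  ...   | no  _       = M

  -- A view of the three branches of `remember`, so that later proofs can match on what happened in
  -- a round without unfolding its `with` clauses.
  data Remembered (M : Memory) (c : Config) (p : V G) : Memory → Set where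
    done    : todo M ≡ [] → Remembered M c p M
    caught  : ∀ {x xs} → todo M ≡ x ∷ xs → ∀ i → Caught M c p x i →
              Remembered M c p (promote M x xs i)
    escaped : ∀ {x xs} → todo M ≡ x ∷ xs → (∀ i → ¬ Caught M c p x i) →
              Remembered M c p M

  remembered : ∀ M c p → Remembered M c p (remember M c p)
  remembered M c p with todo M in eq
  ... | []     = done eq
  ... | x ∷ xs with any? (λ i → c (guard M (pursuer x i)) ≟ shadow x p)
  ...   | yes (i , hit) = caught eq i hit
  ...   | no  miss      = escaped eq (λ i hit → miss (i , hit))

  -- A strategy sees only the history, so the internal state is recomputed from it. Recorded
  -- configurations precede the guards' move of their round; `act` replays that move before the
  -- catch is tested.
  memory : History → Memory
  memory [] = record
    { todo       = allFin N
    ; role       = splitAt e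
    ; guard      = join e N
    ; role-guard = splitAt-join e N
    }
  memory ((c , p) ∷ h) = remember (memory h) (act (memory h) c p) p

  strategy : BStrategy
  strategy = record
    { place = λ _ → base
    ; move  = λ c p h → act (memory h) c p
    ; legal = λ c p h g → play-step (todo (memory h)) (role (memory h) g) p (c g)
    }

  module Play (τ : PStrategy) where

    before : ℕ → Config
    before t = proj₁ (proj₁ (run strategy τ t))

    after : ℕ → Config
    after = bgAfter strategy τ

    president : ℕ → V G
    president = presAt strategy τ

    mem : ℕ → Memory
    mem t = memory (proj₂ (run strategy τ t))

    president-step : ∀ t → Step G (president t) (president (suc t))
    president-step t = PStrategy.legal τ _ _ _

    mem-suc : ∀ t → Remembered (mem t) (after t) (president t) (mem (suc t))
    mem-suc t = remembered (mem t) (after t) (president t)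

    Followed : ℕ → Fin N → Set
    Followed t s = after t (guard (mem t) (inj₂ s)) ≡ shadow s (president t)

    follow : ∀ t s → Step G (before t (guard (mem t) (inj₂ s))) (shadow s (president t)) →
             Followed t s
    follow t s near = trans (act-guard (mem t) (before t) (president t) (inj₂ s)) (hunt-catch near)

    promoted : ∀ M c p {x xs} i → Caught M c p x i → ∀ s →
      (s ∈ x ∷ xs) ⊎ (c (guard M (inj₂ s)) ≡ shadow s p) →
      (s ∈ xs) ⊎ (c (guard (promote M x xs i) (inj₂ s)) ≡ shadow s p)
    promoted M c p {x} {xs} i hit s st = go (s Fin.≟ x) st
      where
      ≢pursuer : s ≢ x → ∀ i → inj₂ s ≢ pursuer x i
      ≢pursuer s≢x zero    refl = s≢x refl
      ≢pursuer s≢x (suc i) ()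
      go : Dec (s ≡ x) → (s ∈ x ∷ xs) ⊎ (c (guard M (inj₂ s)) ≡ shadow s p) →
           (s ∈ xs) ⊎ (c (guard (promote M x xs i) (inj₂ s)) ≡ shadow s p)
      go (yes refl) _                = inj₂ (trans (cong (c ∘ guard M) (swap-right (pursuer x i) (inj₂ x))) hit)
      go (no s≢x) (inj₁ (here s≡x))  = contradiction s≡x s≢x
      go (no s≢x) (inj₁ (there s∈))  = inj₁ s∈
      go (no s≢x) (inj₂ at)          =
        inj₂ (trans (cong (c ∘ guard M) (swap-other (≢pursuer s≢x i) (≢pursuer s≢x zero))) at)

    kept : ∀ {t M} → Remembered (mem t) (after t) (president t) M →
           (∀ s → (s ∈ todo (mem t)) ⊎ Followed t s) →
           ∀ s → (s ∈ todo M) ⊎ (after t (guard M (inj₂ s)) ≡ shadow s (president t))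
    kept (done _)            inv s = inv s
    kept (escaped _ _)       inv s = inv s
    kept {t} (caught eq i hit) inv s =
      promoted (mem t) (after t) (president t) i hit s (Sum.map₁ (subst (s ∈_) eq) (inv s))

    -- Induction on rounds. A shadow leaves the list only when its new follower stands on it, and
    -- later promotions do not touch that role. The shadow then moves at most one step, so
    -- `hunt-catch` puts the follower back on it.
    followed : ∀ t s → (s ∈ todo (mem t)) ⊎ Followed t s
    followed zero    s = inj₁ (∈-allFin s)
    followed (suc t) s = Sum.map₂ near (kept {t} (mem-suc t) (followed t) s)
      where
      near : after t (guard (mem (suc t)) (inj₂ s)) ≡ shadow s (president t) → Followed (suc t) s
      near at = follow (suc t) s
        (subst (λ u → Step G u (shadow s (president (suc t)))) (sym at) (shadow-step s (president-step t)))

    rankSum : Fin N → ℕ → ℕ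
    rankSum x t = sum λ i → rank i (after t (guard (mem t) (pursuer x i))) (shadow x (president t))

    -- With the memory unchanged, both sums speak of the same guards hunting the same shadow. No
    -- summand grows by `rank-≤`, and one shrinks by `rank-<`.
    rankSum-< : ∀ t {x xs} → todo (mem t) ≡ x ∷ xs →
      (∀ i → ¬ Caught (mem t) (after t) (president t) x i) →
      mem (suc t) ≡ mem t → rankSum x (suc t) < rankSum x t
    rankSum-< t {x} eq miss same = subst₂ _<_ (sym (sum-cong-≗ new)) (sym (sum-cong-≗ old))
        (sum-mono-< (λ i → rank-≤ i (w i) (miss′ i) moved) (proj₁ strict) (proj₂ strict))
      where
      M = mem t
      X = shadow x (president t)
      X′ = shadow x (president (suc t))
      w = λ i → before t (guard M (pursuer x i))
      moved : Step G X X′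
      moved = shadow-step x (president-step t)
      here-now : ∀ i → after t (guard M (pursuer x i)) ≡ hunt i (w i) X
      here-now = act-pursuer M eq (before t) (president t)
      here-next : ∀ i → after (suc t) (guard (mem (suc t)) (pursuer x i)) ≡ hunt i (hunt i (w i) X) X′
      here-next i = trans (cong (λ K → act K (after t) (president (suc t)) (guard K (pursuer x i))) same)
        (trans (act-pursuer M eq (after t) (president (suc t)) i) (cong (λ y → hunt i y X′) (here-now i)))
      old : ∀ i → rank i (after t (guard M (pursuer x i))) X ≡ rank i (hunt i (w i) X) X
      old i = cong (λ y → rank i y X) (here-now i)
      new : ∀ i → rank i (after (suc t) (guard (mem (suc t)) (pursuer x i))) X′ ≡ rank i (hunt i (hunt i (w i) X) X′) X′
      new i = cong (λ y → rank i y X′) (here-next i)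
      miss′ : ∀ i → hunt i (w i) X ≢ X
      miss′ i hit = miss i (trans (here-now i) hit)
      strict = rank-< w miss′ moved

    -- Descent on the bound `n`: each round without a catch lowers the rank sum, so a catch must
    -- come.
    catch-one : ∀ n t {x xs} → todo (mem t) ≡ x ∷ xs → rankSum x t < n → ∃ λ t′ → todo (mem t′) ≡ xs
    catch-one (suc n) t {x} {xs} eq (s≤s bound) = go (mem-suc t) refl
      where
      go : ∀ {M} → Remembered (mem t) (after t) (president t) M → mem (suc t) ≡ M →
           ∃ λ t′ → todo (mem t′) ≡ xs
      go (done eq′) _ = case trans (sym eq) eq′ of λ ()
      go (caught eq′ i _) new with refl ← trans (sym eq) eq′ = suc t , cong todo new
      go (escaped eq′ miss) same with refl ← trans (sym eq) eq′ =
        catch-one n (suc t) (trans (cong todo same) eq)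
          (<-≤-trans (rankSum-< t eq miss same) bound)

    catch-all : ∀ xs t → todo (mem t) ≡ xs → ∃ λ t′ → todo (mem t′) ≡ []
    catch-all []       t eq = t , eq
    catch-all (x ∷ xs) t eq with t′ , eq′ ← catch-one _ t eq ≤-refl = catch-all xs t′ eq′

    stable : ∀ {T t} → T ≤′ t → todo (mem T) ≡ [] → todo (mem t) ≡ []
    stable ≤′-refl       eq = eq
    stable {t = suc t} (≤′-step T≤t) eq with eq′ ← stable T≤t eq = go (mem-suc t) refl
      where
      go : ∀ {M} → Remembered (mem t) (after t) (president t) M → mem (suc t) ≡ M →
           todo (mem (suc t)) ≡ []
      go (done _)        same = trans (cong todo same) eq′
      go (escaped _ _)   same = trans (cong todo same) eq′
      go (caught eq″ _ _) _ = case trans (sym eq′) eq″ of λ ()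

    surrounded : ∀ t → todo (mem t) ≡ [] → Surrounded (after t) (president t)
    surrounded t eq v adj with s , refl ← shadow-adj adj with followed t s
    ... | inj₂ at = guard (mem t) (inj₂ s) , at
    ... | inj₁ s∈ with () ← subst (s ∈_) eq s∈

  win : BodyguardsWin
  win = strategy , λ τ → let open Play τ
                             T , eq = catch-all (allFin N) 0 refl
                         in T , λ t T≤t → surrounded t (stable (≤⇒≤′ T≤t) eq)

-- Pursuit on a path

odd : ℕ → Bool
odd zero    = false
odd (suc n) = not (odd n)

odd-n+1+n : ∀ n → odd (n + suc n) ≡ true
odd-n+1+n zero    = refl
odd-n+1+n (suc n) rewrite +-suc n (suc n) = trans (not-involutive _) (odd-n+1+n n)

Nbr : ℕ → ℕ → Set
Nbr x x′ = x′ ≡ suc x ⊎ x ≡ suc x′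

-- Paths are bipartite: a step always flips the parity of the distance. The patient pursuers rely on
-- this.
nbr-dist : ∀ {x x′} → Nbr x x′ → ∀ y → ∣ x′ - y ∣ ≡ suc ∣ x - y ∣ ⊎ ∣ x - y ∣ ≡ suc ∣ x′ - y ∣
nbr-dist (inj₁ refl) y = up _ y
  where
  up : ∀ x y → ∣ suc x - y ∣ ≡ suc ∣ x - y ∣ ⊎ ∣ x - y ∣ ≡ suc ∣ suc x - y ∣
  up zero    zero    = inj₁ refl
  up (suc x) zero    = inj₁ refl
  up zero    (suc y) = inj₂ refl
  up (suc x) (suc y) = up x y
nbr-dist (inj₂ refl) y with nbr-dist (inj₁ refl) y
... | inj₁ eq = inj₂ eq
... | inj₂ eq = inj₁ eq

toward : ℕ → ℕ → ℕ
toward zero    zero    = zero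
toward zero    (suc x) = 1
toward (suc y) zero    = y
toward (suc y) (suc x) = suc (toward y x)

toward-dist : ∀ y x → ∣ x - toward y x ∣ ≡ pred ∣ x - y ∣
toward-dist zero    zero    = refl
toward-dist zero    (suc x) = ∣-∣-identityʳ x
toward-dist (suc y) zero    = refl
toward-dist (suc y) (suc x) = toward-dist y x

toward-step : ∀ y x → y ≡ toward y x ⊎ Nbr y (toward y x)
toward-step zero    zero    = inj₁ refl
toward-step zero    (suc x) = inj₂ (inj₁ refl)
toward-step (suc y) zero    = inj₂ (inj₂ refl)
toward-step (suc y) (suc x) with toward-step y x
... | inj₁ eq        = inj₁ (cong suc eq)
... | inj₂ (inj₁ eq) = inj₂ (inj₁ (cong suc eq))
... | inj₂ (inj₂ eq) = inj₂ (inj₂ (cong suc eq))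

toward-< : ∀ {n y x} → y < n → x < n → toward y x < n
toward-< {y = zero}  {zero}  y<n x<n = y<n
toward-< {y = zero}  {suc x} y<n x<n = ≤-<-trans (s≤s z≤n) x<n
toward-< {y = suc y} {zero}  y<n x<n = <-trans (n<1+n y) y<n
toward-< {y = suc y} {suc x} (s≤s y<n) (s≤s x<n) = s≤s (toward-< y<n x<n)

-- How far x can still run from y on the path with n vertices; arbitrary for x = y.
room : ℕ → ℕ → ℕ → ℕ
room n y x = if y <ᵇ x then n ∸ x else x

room-≤ : ∀ {n} y {x} → x < n → room n y x ≤ n
room-≤ {n} y {x} x<n with y <ᵇ x
... | true  = m∸n≤m n x
... | false = <⇒≤ x<n

room-above : ∀ n {y x} → y < x → room n y x ≡ n ∸ x
room-above n {y} {x} y<x with y <ᵇ x | <⇒<ᵇ y<x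
... | true | _ = refl

room-below : ∀ n {y x} → x ≤ y → room n y x ≡ x
room-below n {y} {x} x≤y with y <ᵇ x in eq
... | false = refl
... | true  = contradiction (<ᵇ⇒< y x (subst T (sym eq) _)) (≤⇒≯ x≤y)

-- Fleeing prey and chaser move in the same direction. The prey therefore stays on the same side of
-- the chaser, with one vertex less in front of it.
room-chase : ∀ {n x x′ y} → Nbr x x′ → x′ < n → ∣ x′ - y ∣ ≡ suc ∣ x - y ∣ → x ≢ y →
             room n (toward y x′) x′ < room n y x
room-chase {n} {x} {_} {y} (inj₁ refl) x′<n away x≢y = subst₂ _<_
    (sym (trans (cong (λ z → room n z (suc x)) (up y≤x)) (room-above n (s≤s y<x))))
    (sym (room-above n y<x)) (∸-monoʳ-< (n<1+n x) (<⇒≤ x′<n))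
  where
  ahead : ∀ x y → ∣ suc x - y ∣ ≡ suc ∣ x - y ∣ → y ≤ x
  ahead x       zero    _  = z≤n
  ahead zero    (suc y) ()
  ahead (suc x) (suc y) eq = s≤s (ahead x y eq)
  up : ∀ {y x} → y ≤ x → toward y (suc x) ≡ suc y
  up {zero}          _         = refl
  up {suc y} {suc x} (s≤s y≤x) = cong suc (up y≤x)
  y≤x = ahead x y away
  y<x = ≤∧≢⇒< y≤x (x≢y ∘ sym)
room-chase {n} {_} {x′} {y} (inj₂ refl) x′<n away x≢y = subst₂ _<_
    (sym (room-below n (down x<y))) (sym (room-below n x<y)) (n<1+n x′)
  where
  behind : ∀ x y → ∣ x - y ∣ ≡ suc ∣ suc x - y ∣ → x < y
  behind zero    (suc y) _  = s≤s z≤n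
  behind (suc x) (suc y) eq = s≤s (behind x y eq)
  behind zero    zero    ()
  behind (suc x) zero    ()
  down : ∀ {y x} → x < y → x ≤ toward y x
  down {suc y} {zero}  _         = z≤n
  down {suc y} {suc x} (s≤s x<y) = s≤s (down x<y)
  x<y = behind x′ y away

-- Meant for the two own distances of a patient pursuer: the prey raises the smaller one from `m`,
-- the pursuer lowers the larger one to `n`, and the imbalance shrinks by two.
narrow : ∀ {m n} → m < n → ∣ suc m - n ∣ < ∣ m - suc n ∣
narrow {zero}  {suc n} _         = s≤s (n≤1+n n)
narrow {suc m} {suc n} (s≤s m<n) = narrow m<n

-- Lexicographic order coded in base `B`: a drop in the leading part is worth at least `B`, more
-- than the new lower part can make up for.
lex-< : ∀ B {x x′ y y′} → y′ < B → x′ < x → x′ * B + y′ < x * B + y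
lex-< B {x} {x′} {y} {y′} y′<B x′<x = begin-strict
  x′ * B + y′   <⟨ +-monoʳ-< (x′ * B) y′<B ⟩
  x′ * B + B    ≡⟨ +-comm (x′ * B) B ⟩
  suc x′ * B    ≤⟨ *-monoˡ-≤ B x′<x ⟩
  x * B         ≤⟨ m≤m+n (x * B) y ⟩
  x * B + y     ∎
  where open ≤-Reasoning

-- Pursuit in coordinates

-- An interface that hides the nested products of `Grid`: vertices become points of a box, and an
-- edge changes exactly one coordinate by one. The chase can then treat all directions alike.
record Coordinates (G : Graph) (k : ℕ) : Set where
  field
    size    : Fin (suc k) → ℕ
    π       : V G → Fin (suc k) → ℕ
    π-<     : ∀ v i → π v i < size i
    π-ext   : ∀ {u v} → (∀ i → π u i ≡ π v i) → u ≡ v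
    set     : V G → ∀ i {x} → x < size i → V G
    set-at  : ∀ v i {x} (x< : x < size i) → π (set v i x<) i ≡ x
    set-off : ∀ v i {x} (x< : x < size i) {j} → j ≢ i → π (set v i x<) j ≡ π v j
    adj⇒    : ∀ {u v} → Adj G u v → ∃ λ i → Nbr (π u i) (π v i) × (∀ {j} → j ≢ i → π u j ≡ π v j)
    adj⇐    : ∀ {u v} i → Nbr (π u i) (π v i) → (∀ {j} → j ≢ i → π u j ≡ π v j) → Adj G u v

  step⇐ : ∀ {u v} i → π u i ≡ π v i ⊎ Nbr (π u i) (π v i) → (∀ {j} → j ≢ i → π u j ≡ π v j) → Step G u v
  step⇐ {u} {v} i (inj₁ eq) off = inj₁ (π-ext same)
    where
    same : ∀ j → π u j ≡ π v j
    same j with j Fin.≟ i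
    ... | yes refl = eq
    ... | no j≢i   = off j≢i
  step⇐ i (inj₂ nbr) off = inj₂ (adj⇐ i nbr off)

-- The pursuer owning a and b; it is the eager one if a ≡ b, and patient otherwise.
module Chaser {G : Graph} {k : ℕ} (coords : Coordinates G k) (a b : Fin (suc k)) where
  open Coordinates coords

  dist : V G → V G → Fin (suc k) → ℕ
  dist y x i = ∣ π x i - π y i ∣

  total : V G → V G → ℕ
  total y x = sum (dist y x)

  total≡0⇒dist≡0 : ∀ {y x} → total y x ≡ 0 → ∀ i → dist y x i ≡ 0
  total≡0⇒dist≡0 {y} {x} = sum-zero⁻ {f = dist y x}

  Own : Fin (suc k) → Set
  Own i = i ≡ a ⊎ i ≡ b

  own? : ∀ i → Dec (Own i)
  own? i = (i Fin.≟ a) ⊎-dec (i Fin.≟ b)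

  own-only : ∀ {l l′ r} → Own l → Own l′ → l ≢ l′ → Own r → r ≡ l ⊎ r ≡ l′
  own-only (inj₁ refl) _           _    (inj₁ refl) = inj₁ refl
  own-only (inj₂ refl) _           _    (inj₂ refl) = inj₁ refl
  own-only _           (inj₁ refl) _    (inj₁ refl) = inj₂ refl
  own-only _           (inj₂ refl) _    (inj₂ refl) = inj₂ refl
  own-only (inj₁ refl) (inj₁ refl) l≢l′ _           = contradiction refl l≢l′
  own-only (inj₂ refl) (inj₂ refl) l≢l′ _           = contradiction refl l≢l′

  outside : (Fin (suc k) → ℕ) → Fin (suc k) → ℕ
  outside f i with own? i
  ... | yes _ = 0
  ... | no  _ = f i

  outside-out : ∀ f {i} → ¬ Own i → outside f i ≡ f i
  outside-out f {i} ¬own with own? i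
  ... | yes own = contradiction own ¬own
  ... | no _    = refl

  outside-≤ : ∀ f i → outside f i ≤ f i
  outside-≤ f i with own? i
  ... | yes _ = z≤n
  ... | no _  = ≤-refl

  outside-cong : ∀ {f g} → (∀ {i} → ¬ Own i → f i ≡ g i) → sum (outside f) ≡ sum (outside g)
  outside-cong {f} {g} eq = sum-cong-≗ pointwise
    where
    pointwise : ∀ i → outside f i ≡ outside g i
    pointwise i with own? i
    ... | yes _   = refl
    ... | no ¬own = eq ¬own

  outside-suc : ∀ {f g} i → ¬ Own i → g i ≡ suc (f i) → (∀ {j} → j ≢ i → g j ≡ f j) →
                sum (outside g) ≡ suc (sum (outside f))
  outside-suc {f} {g} i ¬own at off = sum-suc i
    (trans (outside-out g ¬own) (trans at (cong suc (sym (outside-out f ¬own))))) rest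
    where
    rest : ∀ {j} → j ≢ i → outside g j ≡ outside f j
    rest {j} j≢i with own? j
    ... | yes _ = refl
    ... | no _  = off j≢i

  -- The rule for the coordinate to be closed: a foreign one while any disagrees, otherwise an own
  -- one at the larger distance. With `a ≡ b` the own coordinate is thus left to the end.
  data Selected (f : Fin (suc k) → ℕ) (j : Fin (suc k)) : Set where
    outer : ¬ Own j → f j ≢ 0 → Selected f j
    inner : (∀ {i} → ¬ Own i → f i ≡ 0) → Own j → f a ≤ f j → f b ≤ f j → Selected f j

  -- Opaque, so that proofs depend on `Selected` only and not on how the choice is made.
  abstract
    selection : ∀ f → ∃ (Selected f)
    selection f with any? (λ i → ¬? (own? i) ×-dec ¬? (f i ≟ 0))
    ... | yes (j , ¬own , fj≢0) = j , outer ¬own fj≢0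
    ... | no none = [ (λ a≤b → b , inner zeros (inj₂ refl) a≤b ≤-refl)
                    , (λ b≤a → a , inner zeros (inj₁ refl) ≤-refl b≤a) ]′ (≤-total (f a) (f b))
      where
      zeros : ∀ {i} → ¬ Own i → f i ≡ 0
      zeros {i} ¬own = decidable-stable (f i ≟ 0) λ neq → none (i , ¬own , neq)

  select : (Fin (suc k) → ℕ) → Fin (suc k)
  select f = proj₁ (selection f)

  selected : ∀ f → Selected f (select f)
  selected f = proj₂ (selection f)

  selected-≢0 : ∀ {f j} → sum f ≢ 0 → Selected f j → f j ≢ 0
  selected-≢0 _ (outer _ fj≢0) = fj≢0
  selected-≢0 {f} sum≢0 (inner zeros _ a≤j b≤j) fj≡0 = sum≢0 (sum-zero all)
    where
    all : ∀ i → f i ≡ 0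
    all i with own? i
    ... | yes (inj₁ refl) = n≤0⇒n≡0 (subst (f a ≤_) fj≡0 a≤j)
    ... | yes (inj₂ refl) = n≤0⇒n≡0 (subst (f b ≤_) fj≡0 b≤j)
    ... | no ¬own         = zeros ¬own

  advance : V G → V G → V G
  advance y x = set y j (toward-< (π-< y j) (π-< x j))
    where j = select (dist y x)

  waits : V G → V G → Bool
  waits y x with a Fin.≟ b
  ... | yes _ = false
  ... | no  _ = not (odd (total y x))

  chase : V G → V G → V G
  chase y x = if waits y x then y else advance y x

  module Advance (y x : V G) where
    j = select (dist y x)

    j-selected : Selected (dist y x) j
    j-selected = selected (dist y x)

    π-at : π (advance y x) j ≡ toward (π y j) (π x j)
    π-at = set-at y j _

    π-off : ∀ {i} → i ≢ j → π (advance y x) i ≡ π y i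
    π-off = set-off y j _

    dist-off : ∀ {i} → i ≢ j → dist (advance y x) x i ≡ dist y x i
    dist-off {i} i≢j = cong ∣ π x i -_∣ (π-off i≢j)

    dist-at : dist (advance y x) x j ≡ pred (dist y x j)
    dist-at = trans (cong ∣ π x j -_∣ π-at) (toward-dist (π y j) (π x j))

    dist-at-suc : dist y x j ≢ 0 → dist y x j ≡ suc (dist (advance y x) x j)
    dist-at-suc ≢0 with dist y x j in eq | dist-at
    ... | zero  | _    = contradiction refl ≢0
    ... | suc d | at = cong suc (sym at)

    total-suc : total y x ≢ 0 → total y x ≡ suc (total (advance y x) x)
    total-suc ≢0 = sum-suc j (dist-at-suc (selected-≢0 ≢0 j-selected)) (sym ∘ dist-off)

    total-≤ : total (advance y x) x ≤ total y x
    total-≤ with total y x ≟ 0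
    ... | no ≢0  = ≤-trans (n≤1+n _) (≤-reflexive (sym (total-suc ≢0)))
    ... | yes ≡0 = ≤-reflexive (trans (sum-zero zeros) (sym ≡0))
      where
      zeros : ∀ i → dist (advance y x) x i ≡ 0
      zeros i with i Fin.≟ j
      ... | yes refl = trans dist-at (cong pred (total≡0⇒dist≡0 ≡0 j))
      ... | no i≢j   = trans (dist-off i≢j) (total≡0⇒dist≡0 ≡0 i)

  advance-step : ∀ y x → Step G y (advance y x)
  advance-step y x = step⇐ j
      (subst (λ z → π y j ≡ z ⊎ Nbr (π y j) z) (sym π-at) (toward-step (π y j) (π x j)))
      (sym ∘ π-off)
    where open Advance y x

  chase-step : ∀ y x → Step G y (chase y x)
  chase-step y x with waits y x
  ... | true  = inj₁ refl
  ... | false = advance-step y x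

  total≡0⇒≡ : ∀ {y x} → total y x ≡ 0 → y ≡ x
  total≡0⇒≡ ≡0 = π-ext λ i → sym (∣m-n∣≡0⇒m≡n (total≡0⇒dist≡0 ≡0 i))

  total-self : ∀ y → total y y ≡ 0
  total-self y = sum-zero λ i → ∣n-n∣≡0 (π y i)

  chase-total-≤ : ∀ y x → total (chase y x) x ≤ total y x
  chase-total-≤ y x with waits y x
  ... | true  = ≤-refl
  ... | false = Advance.total-≤ y x

  Ready : V G → V G → Set
  Ready y x = a ≢ b → odd (total y x) ≡ false

  -- A patient pursuer waits at even distance; an odd distance is nonzero, so advancing lowers it by
  -- one. Either way its turn ends at even distance.
  chase-ready : ∀ y x → Ready (chase y x) x
  chase-ready y x a≢b with a Fin.≟ b
  ... | yes a≡b = contradiction a≡b a≢b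
  ... | no _ with odd (total y x) in eq
  ...   | false = eq
  ...   | true  = trans (sym (not-involutive _)) (cong not (trans (cong odd (sym (Advance.total-suc y x ≢0))) eq))
    where
    ≢0 : total y x ≢ 0
    ≢0 ≡0 = case trans (sym eq) (cong odd ≡0) of λ ()

  -- A base above every lower digit of `rank`: the outside distances add up to at most `sum size`,
  -- while `gap` and `slack` are at most `size a + size b`. The leading digit `total` needs no
  -- bound.
  B : ℕ
  B = suc (sum size + (size a + size b))

  gap slack : V G → V G → ℕ
  gap y x = ∣ dist y x a - dist y x b ∣
  slack y x = room (size a) (π y a) (π x a) + room (size b) (π y b) (π x b)

  rank : V G → V G → ℕ
  rank y x = ((total y x * B + sum (outside (dist y x))) * B + gap y x) * B + slack y x

  dist-≤ : ∀ y x i → dist y x i ≤ size i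
  dist-≤ y x i = ≤-trans (∣m-n∣≤m⊔n (π x i) (π y i)) (⊔-lub (<⇒≤ (π-< x i)) (<⇒≤ (π-< y i)))

  outside-<B : ∀ y x → sum (outside (dist y x)) < B
  outside-<B y x = s≤s (≤-trans (sum-mono-≤ λ i → ≤-trans (outside-≤ (dist y x) i) (dist-≤ y x i))
                                (m≤m+n _ _))

  gap-<B : ∀ y x → gap y x < B
  gap-<B y x = s≤s (≤-trans (≤-trans (≤-trans (∣m-n∣≤m⊔n (dist y x a) (dist y x b)) (m⊔n≤m+n (dist y x a) _))
                                     (+-mono-≤ (dist-≤ y x a) (dist-≤ y x b)))
                            (m≤n+m _ (sum size)))

  slack-<B : ∀ y x → slack y x < B
  slack-<B y x = s≤s (≤-trans (+-mono-≤ (room-≤ (π y a) (π-< x a)) (room-≤ (π y b) (π-< x b)))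
                              (m≤n+m _ (sum size)))

  module _ {y x y′ x′ : V G} where

    rank-total : total y′ x′ < total y x → rank y′ x′ < rank y x
    rank-total lt = lex-< B (slack-<B y′ x′) (lex-< B (gap-<B y′ x′) (lex-< B (outside-<B y′ x′) lt))

    rank-outside : total y′ x′ ≡ total y x → sum (outside (dist y′ x′)) < sum (outside (dist y x)) →
                   rank y′ x′ < rank y x
    rank-outside eq lt = lex-< B (slack-<B y′ x′) (lex-< B (gap-<B y′ x′)
      (subst (λ n → n * B + sum (outside (dist y′ x′)) < total y x * B + sum (outside (dist y x)))
             (sym eq) (+-monoʳ-< (total y x * B) lt)))

    module _ (eq : total y′ x′ ≡ total y x)
             (eq₁ : sum (outside (dist y′ x′)) ≡ sum (outside (dist y x))) where

      rank-gap : gap y′ x′ < gap y x → rank y′ x′ < rank y x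
      rank-gap lt = lex-< B (slack-<B y′ x′)
        (subst (λ n → n * B + gap y′ x′ < (total y x * B + sum (outside (dist y x))) * B + gap y x)
               (sym (cong₂ (λ m n → m * B + n) eq eq₁)) (+-monoʳ-< _ lt))

      rank-slack : gap y′ x′ ≡ gap y x → slack y′ x′ < slack y x → rank y′ x′ < rank y x
      rank-slack eq₂ lt = ≤-<-trans (≤-reflexive (cong₂ (λ m n → (m * B + n) * B + slack y′ x′)
                                       (cong₂ (λ m n → m * B + n) eq eq₁) eq₂))
                                    (+-monoʳ-< (((total y x * B + sum (outside (dist y x))) * B + gap y x) * B) lt)

      rank-same : gap y′ x′ ≡ gap y x → slack y′ x′ ≡ slack y x → rank y′ x′ ≡ rank y x
      rank-same eq₂ eq₃ = cong₂ (λ m n → m * B + n)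
        (cong₂ (λ m n → m * B + n) (cong₂ (λ m n → m * B + n) eq eq₁) eq₂) eq₃

  chase-odd : ∀ {y x} → (a ≢ b → odd (total y x) ≡ true) → chase y x ≡ advance y x
  chase-odd {y} {x} isOdd with a Fin.≟ b
  ... | yes _  = refl
  ... | no a≢b rewrite isOdd a≢b = refl

  -- Against resting prey the eager pursuer comes closer, whereas a patient one, being at even
  -- distance, waits and nothing changes.
  rank-rest : ∀ {y x} → Ready y x → y ≢ x →
              rank (chase y x) x < rank y x ⊎ (a ≢ b × rank (chase y x) x ≡ rank y x)
  rank-rest {y} {x} ready y≢x with a Fin.≟ b
  ... | yes a≡b = inj₁ (rank-total {y} {x} {advance y x} {x}
                    (≤-reflexive (sym (Advance.total-suc y x (y≢x ∘ total≡0⇒≡)))))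
  ... | no a≢b rewrite ready a≢b = inj₂ (a≢b , refl)

  module Flight {y x x′ : V G} (ready : Ready y x) (y≢x : y ≢ x) (i : Fin (suc k))
                (nbr : Nbr (π x i) (π x′ i)) (off : ∀ {l} → l ≢ i → π x l ≡ π x′ l) where

    -- The rank may stand still only in directions that are not own, so the owner of the direction
    -- of flight always makes progress.
    Outcome : V G → Set
    Outcome y′ = rank y′ x′ < rank y x ⊎ (¬ Own i × rank y′ x′ ≡ rank y x)

    unmoved : ∀ {l} → l ≢ i → dist y x′ l ≡ dist y x l
    unmoved {l} l≢i = cong ∣_- π y l ∣ (sym (off l≢i))

    module Away (away : dist y x′ i ≡ suc (dist y x i)) where
      open Advance y x′ renaming (dist-off to pursued-off; dist-at-suc to pursued-at)

      y′ = advance y x′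

      total-x′ : total y x′ ≡ suc (total y x)
      total-x′ = sum-suc i away unmoved

      total-same : total y′ x′ ≡ total y x
      total-same = suc-injective (trans (sym (total-suc λ ≡0 → case trans (sym total-x′) ≡0 of λ ())) total-x′)

      chases : chase y x′ ≡ y′
      -- The total was even by `ready` and the flight added one, so a patient pursuer moves as well.
      chases = chase-odd λ a≢b → trans (cong odd total-x′) (cong not (ready a≢b))

      other : ∀ {l} → l ≢ i → l ≢ j → π y′ l ≡ π y l × π x′ l ≡ π x l
      other l≢i l≢j = π-off l≢j , sym (off l≢i)

      other-dist : ∀ {l} → l ≢ i → l ≢ j → dist y′ x′ l ≡ dist y x l
      other-dist l≢i l≢j = trans (pursued-off l≢j) (unmoved l≢i)

      roomAt : V G → V G → Fin (suc k) → ℕ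
      roomAt u v l = room (size l) (π u l) (π v l)

      other-room : ∀ {l} → l ≢ i → l ≢ j → roomAt y′ x′ l ≡ roomAt y x l
      other-room {l} l≢i l≢j = cong₂ (room (size l)) (proj₁ (other l≢i l≢j)) (proj₂ (other l≢i l≢j))

      -- The pursuer closes a foreign coordinate. If the prey fled in an own direction, the outside
      -- distance drops. Otherwise it goes up and down by one, while the own coordinates of both
      -- stay put, so the whole rank is kept.
      out-case : ¬ Own j → dist y x′ j ≢ 0 → Outcome y′
      out-case ¬ownj ≢0 with own? i
      ... | yes owni = inj₁ (rank-outside total-same (≤-reflexive (trans
              (sym (outside-suc j ¬ownj (pursued-at ≢0) (sym ∘ pursued-off)))
              (outside-cong λ ¬own → unmoved λ { refl → ¬own owni }))))
      ... | no ¬owni = inj₂ (¬owni , rank-same total-same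
              (suc-injective (trans (sym (outside-suc j ¬ownj (pursued-at ≢0) (sym ∘ pursued-off)))
                                    (outside-suc i ¬owni away unmoved)))
              (cong₂ ∣_-_∣ (same (inj₁ refl) other-dist) (same (inj₂ refl) other-dist))
              (cong₂ _+_ (same (inj₁ refl) other-room) (same (inj₂ refl) other-room)))
        where
        same : ∀ {l} {A : Set} → Own l → (l ≢ i → l ≢ j → A) → A
        same own f = f (λ { refl → ¬owni own }) (λ { refl → ¬ownj own })

      module OwnCase (zeros : ∀ {l} → ¬ Own l → dist y x′ l ≡ 0) (ownj : Own j)
                     (a≤j : dist y x′ a ≤ dist y x′ j) (b≤j : dist y x′ b ≤ dist y x′ j) where

        own-≤ : ∀ {l} → Own l → dist y x′ l ≤ dist y x′ j
        own-≤ (inj₁ refl) = a≤j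
        own-≤ (inj₂ refl) = b≤j

        -- The flight made the distance at `i` positive, but all foreign distances vanish.
        owni : Own i
        owni = decidable-stable (own? i) λ ¬own → case trans (sym away) (zeros ¬own) of λ ()

        outside-same : sum (outside (dist y′ x′)) ≡ sum (outside (dist y x))
        outside-same = outside-cong λ ¬own → other-dist (λ { refl → ¬own owni }) (λ { refl → ¬own ownj })

        -- The only use of patience: after a tie the two distances could swap forever.
        no-tie : ∀ {l l′} → Own l → Own l′ → l ≢ l′ → dist y x l′ ≢ suc (dist y x l)
        no-tie {l} {l′} ownl ownl′ l≢l′ tie = case trans (sym (odd-n+1+n (dist y x l)))
            (trans (cong (λ n → odd (dist y x l + n)) (sym tie)) (trans (cong odd (sym split)) (ready a≢b))) of λ ()
          where
          -- Two different own coordinates exist only for a patient pursuer, which makes the parity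
          -- in `ready` available.
          a≢b : a ≢ b
          a≢b refl = l≢l′ (trans (Sum.reduce ownl) (sym (Sum.reduce ownl′)))
          split : total y x ≡ dist y x l + dist y x l′
          split = sum-pair l≢l′ λ r≢l r≢l′ → let ¬own = [ r≢l , r≢l′ ]′ ∘ own-only ownl ownl′ l≢l′ in
            trans (sym (unmoved λ { refl → ¬own owni })) (zeros ¬own)

        -- The pursuer answers in the direction of flight. All distances are restored, and only the
        -- room of the prey shrinks.
        mirror : j ≡ i → Outcome y′
        mirror j≡i = inj₁ (rank-slack total-same outside-same
            (cong₂ ∣_-_∣ (dist-same a) (dist-same b)) (slack-< owni))
          where
          ≢j : ∀ {l} → l ≢ i → l ≢ j
          ≢j l≢i l≡j = l≢i (trans l≡j j≡i)
          π-i : π y′ i ≡ toward (π y i) (π x′ i)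
          π-i = subst (λ r → π y′ r ≡ toward (π y r) (π x′ r)) j≡i π-at
          dist-i : dist y′ x′ i ≡ dist y x i
          dist-i = trans (cong ∣ π x′ i -_∣ π-i) (trans (toward-dist (π y i) (π x′ i)) (cong pred away))
          dist-same : ∀ l → dist y′ x′ l ≡ dist y x l
          dist-same l with l Fin.≟ i
          ... | yes refl = dist-i
          ... | no l≢i   = other-dist l≢i (≢j l≢i)
          -- If it were zero, the selected distance would now be one, so any other own distance is
          -- at most one. It is not one by `no-tie`, hence all distances were zero and the prey was
          -- already caught.
          dist≢0 : dist y x i ≢ 0
          dist≢0 ≡0 = y≢x (total≡0⇒≡ (sum-zero zero-at))
            where
            zero-at : ∀ l → dist y x l ≡ 0
            zero-at l with l Fin.≟ i | own? l
            ... | yes refl | _       = ≡0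
            ... | no l≢i   | no ¬own = trans (sym (unmoved l≢i)) (zeros ¬own)
            ... | no l≢i   | yes ownl = n<1⇒n≡0 (≤∧≢⇒<
                    (subst₂ _≤_ (unmoved l≢i) (trans (cong (dist y x′) j≡i) (trans away (cong suc ≡0))) (own-≤ ownl))
                    (λ ≡1 → no-tie owni ownl (l≢i ∘ sym) (trans ≡1 (cong suc (sym ≡0)))))
          room-< : roomAt y′ x′ i < roomAt y x i
          room-< = subst (λ z → room (size i) z (π x′ i) < roomAt y x i) (sym π-i)
            (room-chase nbr (π-< x′ i) away (dist≢0 ∘ m≡n⇒∣m-n∣≡0))
          room-≤′ : ∀ l → roomAt y′ x′ l ≤ roomAt y x l
          room-≤′ l with l Fin.≟ i
          ... | yes refl = <⇒≤ room-<
          ... | no l≢i   = ≤-reflexive (other-room l≢i (≢j l≢i))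
          slack-< : Own i → slack y′ x′ < slack y x
          slack-< (inj₁ refl) = +-mono-<-≤ room-< (room-≤′ b)
          slack-< (inj₂ refl) = +-mono-≤-< (room-≤′ a) room-<

        -- The prey raised one own distance and the pursuer lowers the other, larger one. By
        -- `no-tie` the larger exceeded the smaller by at least two before the flight, so the
        -- imbalance really shrinks.
        balance : j ≢ i → Outcome y′
        balance j≢i = inj₁ (rank-gap total-same outside-same (gap-< owni ownj))
          where
          dist-j : dist y x j ≡ suc (dist y′ x′ j)
          dist-j = trans (sym (unmoved j≢i)) (pursued-at λ ≡0 →
            case ≤-trans (≤-reflexive (sym away)) (≤-trans (own-≤ owni) (≤-reflexive ≡0)) of λ ())
          dist-i : dist y′ x′ i ≡ suc (dist y x i)
          dist-i = trans (pursued-off (j≢i ∘ sym)) away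
          i<j : dist y x i < dist y′ x′ j
          i<j = s≤s⁻¹ (subst (suc (dist y x i) <_) dist-j (≤∧≢⇒<
            (subst₂ _≤_ away (unmoved j≢i) (own-≤ owni)) (no-tie owni ownj (j≢i ∘ sym) ∘ sym)))
          narrowed : ∣ dist y′ x′ i - dist y′ x′ j ∣ < ∣ dist y x i - dist y x j ∣
          narrowed = subst₂ (λ m n → ∣ m - dist y′ x′ j ∣ < ∣ dist y x i - n ∣) (sym dist-i) (sym dist-j) (narrow i<j)
          gap-< : Own i → Own j → gap y′ x′ < gap y x
          gap-< (inj₁ refl) (inj₁ j≡a) = contradiction j≡a j≢i
          gap-< (inj₂ refl) (inj₂ j≡b) = contradiction j≡b j≢i
          gap-< (inj₁ refl) (inj₂ j≡b) = subst (λ r → ∣ dist y′ x′ a - dist y′ x′ r ∣ < ∣ dist y x a - dist y x r ∣) j≡b narrowed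
          gap-< (inj₂ refl) (inj₁ j≡a) = subst₂ _<_ (∣-∣-comm (dist y′ x′ b) _) (∣-∣-comm (dist y x b) _)
            (subst (λ r → ∣ dist y′ x′ b - dist y′ x′ r ∣ < ∣ dist y x b - dist y x r ∣) j≡a narrowed)

        outcome : Outcome y′
        outcome with j Fin.≟ i
        ... | yes j≡i = mirror j≡i
        ... | no  j≢i = balance j≢i

      outcome : Outcome y′
      outcome with j-selected
      ... | outer ¬ownj ≢0             = out-case ¬ownj ≢0
      ... | inner zeros ownj a≤j b≤j   = OwnCase.outcome zeros ownj a≤j b≤j

    rank-flight : Outcome (chase y x′)
    rank-flight with nbr-dist nbr (π y i)
    ... | inj₁ away = subst Outcome (sym (Away.chases away)) (Away.outcome away)
    -- The prey itself shortened the total distance, and the pursuer's turn cannot lengthen it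
    -- again.
    ... | inj₂ near = inj₁ (rank-total (≤-<-trans (chase-total-≤ y x′)
                        (≤-reflexive (sym (sum-suc i near (sym ∘ unmoved))))))

-- Pairs of coordinates and clamped shifts

pairs : ∀ n → Fin ⌊ n /2⌋ → Fin n × Fin n
pairs (suc (suc n)) zero    = zero , suc zero
pairs (suc (suc n)) (suc i) = map (2 ↑ʳ_) (2 ↑ʳ_) (pairs n i)

pairs-distinct : ∀ n i → proj₁ (pairs n i) ≢ proj₂ (pairs n i)
pairs-distinct (suc (suc n)) zero    ()
pairs-distinct (suc (suc n)) (suc i) eq = pairs-distinct n i (Fin.suc-injective (Fin.suc-injective eq))

-- Consecutive indices are paired from the front, so only the last one can be left over, for odd
-- `n`. It falls to the eager pursuer.
pairs-cover : ∀ n (l : Fin n) →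
  suc (toℕ l) ≡ n ⊎ ∃ λ i → l ≡ proj₁ (pairs n i) ⊎ l ≡ proj₂ (pairs n i)
pairs-cover (suc zero)    zero          = inj₁ refl
pairs-cover (suc (suc n)) zero          = inj₂ (zero , inj₁ refl)
pairs-cover (suc (suc n)) (suc zero)    = inj₂ (zero , inj₂ refl)
pairs-cover (suc (suc n)) (suc (suc l)) =
  Sum.map (cong (2 +_)) (map suc (Sum.map (cong (2 ↑ʳ_)) (cong (2 ↑ʳ_)))) (pairs-cover n l)

-- Beyond the border the shadow stays with the president.
shift : Fin 2 → ℕ → ℕ → ℕ
shift zero       n x = pred x
shift (suc zero) n x = suc x ⊓ pred n

shift-< : ∀ δ {n x} → x < n → shift δ n x < n
shift-< zero       {x = x} x<n = ≤-<-trans (pred[n]≤n {x}) x<n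
shift-< (suc zero) {suc n} {x} _ = s≤s (m⊓n≤n (suc x) n)

shift-suc : ∀ δ n x → shift δ n (suc x) ≡ shift δ n x ⊎ shift δ n (suc x) ≡ suc (shift δ n x)
shift-suc zero       n zero    = inj₁ refl
shift-suc zero       n (suc x) = inj₂ refl
shift-suc (suc zero) n x       = ⊓-suc (suc x) (pred n)
  where
  ⊓-suc : ∀ x m → suc x ⊓ m ≡ x ⊓ m ⊎ suc x ⊓ m ≡ suc (x ⊓ m)
  ⊓-suc zero    zero    = inj₁ refl
  ⊓-suc (suc x) zero    = inj₁ refl
  ⊓-suc zero    (suc m) = inj₂ refl
  ⊓-suc (suc x) (suc m) = Sum.map (cong suc) (cong suc) (⊓-suc x m)

shift-nbr : ∀ δ n {x x′} → Nbr x x′ → shift δ n x ≡ shift δ n x′ ⊎ Nbr (shift δ n x) (shift δ n x′)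
shift-nbr δ n (inj₁ refl) = Sum.map sym inj₁ (shift-suc δ n _)
shift-nbr δ n (inj₂ refl) = Sum.map₂ inj₂ (shift-suc δ n _)

-- The team of pursuers and the shadows of the president

module Team {G : Graph} {k : ℕ} (coords : Coordinates G k) where
  open Coordinates coords

  _≟V_ : DecidableEquality (V G)
  u ≟V v = map′ π-ext (λ { refl _ → refl }) (all? λ i → π u i ≟ π v i)

  module Eager (a : Fin (suc k)) where
    open Chaser coords a a

    total-adj : ∀ {y x} → Adj G y x → total y x ≡ 1
    total-adj {y} {x} adj with i , nbr , off ← adj⇒ adj =
        -- Compare with prey sitting at `y`, where all distances are zero: the edge raises exactly
        -- one of them.
        trans (sum-suc {f = dist y y} i at (λ {j} j≢i → cong ∣_- π y j ∣ (sym (off j≢i)))) (cong suc (total-self y))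
      where
      at : dist y x i ≡ suc (dist y y i)
      at with nbr-dist nbr (π y i)
      ... | inj₁ eq = eq
      ... | inj₂ eq = case trans (sym (∣n-n∣≡0 (π y i))) eq of λ ()

    -- At distance zero the chase cannot increase the distance; at distance one the eager pursuer,
    -- who never waits, removes it.
    chase-catch : ∀ {y x} → Step G y x → chase y x ≡ x
    chase-catch {y} (inj₁ refl) = total≡0⇒≡ (n≤0⇒n≡0 (subst (total (chase y y) y ≤_) (total-self y) (chase-total-≤ y y)))
    chase-catch {y} {x} (inj₂ adj) = trans (chase-odd λ a≢a → contradiction refl a≢a) (total≡0⇒≡ (suc-injective
      (trans (sym (Advance.total-suc y x λ ≡0 → case trans (sym (total-adj adj)) ≡0 of λ ())) (total-adj adj))))

  -- The repeated coordinate makes index `zero` the eager pursuer, as `hunt-catch` requires.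
  duty : Fin (suc ⌊ suc k /2⌋) → Fin (suc k) × Fin (suc k)
  duty zero    = fromℕ k , fromℕ k
  duty (suc i) = pairs (suc k) i

  module Member i = Chaser coords (proj₁ (duty i)) (proj₂ (duty i))

  duty-cover : ∀ l → ∃ λ i → Member.Own i l
  duty-cover l with pairs-cover (suc k) l
  ... | inj₁ eq        = zero , inj₁ (toℕ-injective (trans (suc-injective eq) (sym (toℕ-fromℕ k))))
  ... | inj₂ (i , own) = suc i , own

  pursuers : Pursuers G ⌊ suc k /2⌋
  pursuers = record
    { hunt       = Member.chase
    ; hunt-step  = Member.chase-step
    ; hunt-catch = Eager.chase-catch (fromℕ k)
    ; rank       = Member.rank
    ; rank-≤     = rank-≤
    ; rank-<     = rank-<
    }
    where
    open Member using (chase; rank; chase-ready; rank-rest)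

    weaken : ∀ {m n} {A : Set} → m < n ⊎ (A × m ≡ n) → m ≤ n
    weaken (inj₁ m<n)       = <⇒≤ m<n
    weaken (inj₂ (_ , m≡n)) = ≤-reflexive m≡n

    rank-≤ : ∀ i w {x x′} → chase i w x ≢ x → Step G x x′ →
             rank i (chase i (chase i w x) x′) x′ ≤ rank i (chase i w x) x
    -- The rank is compared from the end of a turn on, so `chase-ready` supplies the parity.
    rank-≤ i w miss (inj₁ refl) = weaken (rank-rest i (chase-ready i w _) miss)
    rank-≤ i w miss (inj₂ adj) with l , nbr , off ← adj⇒ adj =
      weaken (Member.Flight.rank-flight i (chase-ready i w _) miss l nbr off)

    rank-< : ∀ (w : Fin (suc ⌊ suc k /2⌋) → V G) {x x′} → (∀ i → chase i (w i) x ≢ x) → Step G x x′ →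
             ∃ λ i → rank i (chase i (chase i (w i) x) x′) x′ < rank i (chase i (w i) x) x
    rank-< w miss (inj₁ refl) with rank-rest zero (chase-ready zero (w zero) _) (miss zero)
    ... | inj₁ lt        = zero , lt
    ... | inj₂ (a≢a , _) = contradiction refl a≢a
    rank-< w miss (inj₂ adj) with l , nbr , off ← adj⇒ adj with i , own ← duty-cover l
      with Member.Flight.rank-flight i (chase-ready i (w i) _) (miss i) l nbr off
    ... | inj₁ lt         = i , lt
    ... | inj₂ (¬own , _) = contradiction own ¬own

  image : Fin (suc k) → Fin 2 → V G → V G
  image i δ p = set p i (shift-< δ (π-< p i))

  image-at : ∀ i δ p → π (image i δ p) i ≡ shift δ (size i) (π p i)
  image-at i δ p = set-at p i _

  image-off : ∀ i δ p {l} → l ≢ i → π (image i δ p) l ≡ π p l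
  image-off i δ p = set-off p i _

  -- A move in direction `i` passes through the clamped shift, which may stall at the border but
  -- never stretches a step. A move in another direction is copied in parallel.
  image-step : ∀ i δ {p p′} → Step G p p′ → Step G (image i δ p) (image i δ p′)
  image-step i δ (inj₁ refl) = inj₁ refl
  image-step i δ {p} {p′} (inj₂ adj) with l , nbr , off ← adj⇒ adj with l Fin.≟ i
  ... | yes refl = step⇐ l
          (subst₂ (λ m n → m ≡ n ⊎ Nbr m n) (sym (image-at l δ p)) (sym (image-at l δ p′)) (shift-nbr δ (size l) nbr))
          (λ r≢l → trans (image-off l δ p r≢l) (trans (off r≢l) (sym (image-off l δ p′ r≢l))))
  ... | no l≢i = inj₂ (adj⇐ l
          (subst₂ Nbr (sym (image-off i δ p l≢i)) (sym (image-off i δ p′ l≢i)) nbr) rest)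
    where
    rest : ∀ {r} → r ≢ l → π (image i δ p) r ≡ π (image i δ p′) r
    rest {r} r≢l with r Fin.≟ i
    ... | yes refl = trans (image-at i δ p) (trans (cong (shift δ (size i)) (off r≢l)) (sym (image-at i δ p′)))
    ... | no r≢i   = trans (image-off i δ p r≢i) (trans (off r≢l) (sym (image-off i δ p′ r≢i)))

  image-adj : ∀ {p v} → Adj G p v → ∃ λ i → ∃ λ δ → image i δ p ≡ v
  image-adj {p} {v} adj with l , nbr , off ← adj⇒ adj = l , proj₁ (reach nbr) , π-ext same
    where
    reach : Nbr (π p l) (π v l) → ∃ λ δ → shift δ (size l) (π p l) ≡ π v l
    reach (inj₂ eq) = zero , cong pred eq
    -- The neighbour lies in the grid, so the clamp is inactive.
    reach (inj₁ eq) = suc zero , trans (cong (_⊓ pred (size l)) (sym eq)) (m≤n⇒m⊓n≡m (<⇒≤pred (π-< v l)))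
    same : ∀ r → π (image l (proj₁ (reach nbr)) p) r ≡ π v r
    same r with r Fin.≟ l
    ... | yes refl = trans (image-at l (proj₁ (reach nbr)) p) (proj₂ (reach nbr))
    ... | no r≢l   = trans (image-off l (proj₁ (reach nbr)) p r≢l) (off r≢l)

  shadows : Shadows G (suc k * 2)
  shadows = record
    { shadow      = λ s → let i , δ = remQuot {suc k} 2 s in image i δ
    ; shadow-step = λ s → let i , δ = remQuot {suc k} 2 s in image-step i δ
    ; shadow-adj  = λ {p} adj → let i , δ , eq = image-adj adj in
        combine i δ , trans (cong (λ q → image (proj₁ q) (proj₂ q) p) (remQuot-combine i δ)) eq
    }

  guards-win : V G → Game.BodyguardsWin G (⌊ suc k /2⌋ + suc k * 2)
  guards-win base = Escort.win G _≟V_ base pursuers shadows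

-- Coordinates on grids

path : ∀ n → Coordinates (P n) 0
path n = record
  { size    = λ _ → n
  ; π       = λ v _ → toℕ v
  ; π-<     = λ v _ → toℕ<n v
  ; π-ext   = λ eq → toℕ-injective (eq zero)
  ; set     = λ _ _ x< → fromℕ< x<
  ; set-at  = λ _ _ x< → toℕ-fromℕ< x<
  ; set-off = λ { _ zero _ {zero} 0≢0 → contradiction refl 0≢0 }
  ; adj⇒    = λ adj → zero , adj , λ { {zero} 0≢0 → contradiction refl 0≢0 }
  ; adj⇐    = λ _ nbr _ → nbr
  }

prism : ∀ n {H k} → Coordinates H k → Coordinates (P n □ H) (suc k)
prism n {H} {k} coords = record
  { size = size′ ; π = π′ ; π-< = π′-<
  ; π-ext   = λ eq → cong₂ _,_ (toℕ-injective (eq zero)) (π-ext (eq ∘ suc))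
  ; set = set′ ; set-at = set′-at ; set-off = set′-off
  ; adj⇒ = adj′⇒ ; adj⇐ = adj′⇐
  }
  where
  open Coordinates coords
  size′ : Fin (suc (suc k)) → ℕ
  size′ zero    = n
  size′ (suc i) = size i
  π′ : Fin n × V H → Fin (suc (suc k)) → ℕ
  π′ (u , v) zero    = toℕ u
  π′ (u , v) (suc i) = π v i
  π′-< : ∀ v i → π′ v i < size′ i
  π′-< (u , v) zero    = toℕ<n u
  π′-< (u , v) (suc i) = π-< v i
  set′ : Fin n × V H → ∀ i {x} → x < size′ i → Fin n × V H
  set′ (u , v) zero    x< = fromℕ< x< , v
  set′ (u , v) (suc i) x< = u , set v i x<
  set′-at : ∀ v i {x} (x< : x < size′ i) → π′ (set′ v i x<) i ≡ x
  set′-at (u , v) zero    x< = toℕ-fromℕ< x<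
  set′-at (u , v) (suc i) x< = set-at v i x<
  set′-off : ∀ v i {x} (x< : x < size′ i) {j} → j ≢ i → π′ (set′ v i x<) j ≡ π′ v j
  set′-off _       zero    x< {zero}  0≢0 = contradiction refl 0≢0
  set′-off _       zero    x< {suc j} _   = refl
  set′-off _       (suc i) x< {zero}  _   = refl
  set′-off (u , v) (suc i) x< {suc j} j≢i = set-off v i x< (j≢i ∘ cong suc)
  adj′⇒ : ∀ {u v} → Adj (P n □ H) u v → ∃ λ i → Nbr (π′ u i) (π′ v i) × (∀ {j} → j ≢ i → π′ u j ≡ π′ v j)
  adj′⇒ (inj₁ (nbr , refl)) = zero , nbr , λ { {zero} 0≢0 → contradiction refl 0≢0 ; {suc j} _ → refl }
  adj′⇒ (inj₂ (refl , adj)) with i , nbr , off ← adj⇒ adj =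
    suc i , nbr , λ { {zero} _ → refl ; {suc j} j≢i → off (j≢i ∘ cong suc) }
  adj′⇐ : ∀ {u v} i → Nbr (π′ u i) (π′ v i) → (∀ {j} → j ≢ i → π′ u j ≡ π′ v j) → Adj (P n □ H) u v
  adj′⇐ zero    nbr off = inj₁ (nbr , π-ext λ i → off {suc i} λ ())
  adj′⇐ (suc i) nbr off = inj₂ (toℕ-injective (off {zero} λ ()) , adj⇐ i nbr λ j≢i → off (j≢i ∘ Fin.suc-injective))

grid : ∀ {k} (ns : Vec ℕ (suc k)) → Coordinates (Grid ns) k
grid (n ∷ [])     = path n
grid (n ∷ m ∷ ns) = prism n (grid (m ∷ ns))

corner : ∀ {k} (ns : Vec ℕ (suc k)) → (∀ i → 2 ≤ lookup ns i) → V (Grid ns)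
corner (n ∷ [])     2≤ = fromℕ< (<⇒≤ (2≤ zero))
corner (n ∷ m ∷ ns) 2≤ = fromℕ< (<⇒≤ (2≤ zero)) , corner (m ∷ ns) (2≤ ∘ suc)

-- The number of guards

⌊n/2⌋*2≤n : ∀ n → ⌊ n /2⌋ * 2 ≤ n
⌊n/2⌋*2≤n zero          = z≤n
⌊n/2⌋*2≤n (suc zero)    = z≤n
⌊n/2⌋*2≤n (suc (suc n)) = s≤s (s≤s (⌊n/2⌋*2≤n n))

-- Doubling both sides removes the roundings: twice the left side is at most `n + 4n`.
guards-≤ : ∀ n → ⌊ n /2⌋ + n * 2 ≤ (5 * n) / 2
guards-≤ n = begin
  ⌊ n /2⌋ + n * 2              ≡⟨ m*n/n≡m _ 2 ⟨
  ((⌊ n /2⌋ + n * 2) * 2) / 2  ≤⟨ /-monoˡ-≤ 2 doubled ⟩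
  (5 * n) / 2                  ∎
  where
  open ≤-Reasoning
  doubled : (⌊ n /2⌋ + n * 2) * 2 ≤ 5 * n
  doubled = begin
    (⌊ n /2⌋ + n * 2) * 2      ≡⟨ *-distribʳ-+ 2 ⌊ n /2⌋ (n * 2) ⟩
    ⌊ n /2⌋ * 2 + n * 2 * 2    ≤⟨ +-monoˡ-≤ (n * 2 * 2) (⌊n/2⌋*2≤n n) ⟩
    n + n * 2 * 2              ≡⟨ solve 1 (λ n → n :+ n :* con 2 :* con 2 := con 5 :* n) refl n ⟩
    5 * n                      ∎
    where open +-*-Solver

theorem4p7 : (k' : ℕ) (ns : Vec ℕ (suc k')) → (∀ i → 2 ≤ lookup ns i) →
    BG≤ (Grid ns) ((5 * suc k') / 2)
theorem4p7 k' ns 2≤ =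
  ⌊ suc k' /2⌋ + suc k' * 2 , guards-≤ (suc k') , Team.guards-win (grid ns) (corner ns 2≤)
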